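{- Let $G$ be a connected graph that contains no induced subgraph isomorphic to $P_2\cup P_4$ and no induced subgraph isomorphic to $C_3$. Then at least one of the following holds: (i) $G$ has a comparable pair, i.e. two nonadjacent vertices $u,v$ with $N(u)\subseteq N(v)$; (ii) $\chi(G)\le 3$; (iii) $G$ contains the Mycielski–Grötzsch graph $F_1$ as an induced subgraph, and $G$ is isomorphic to an induced subgraph of the Clebsch graph $F_2$.
   Context: All graphs are finite and simple. $P_k$ and $C_k$ denote the path and the cycle on $k$ vertices; $P_2\cup P_4$ is the disjoint union of $P_2$ and $P_4$. $N(u)$ is the set of neighbours of $u$. $\chi(G)$ is the chromatic number. The Mycielski–Grötzsch graph $F_1$ has 11 vertices $v_1,\dots,v_5,w_1,\dots,w_5,z$, where $v_1v_2v_3v_4v_5v_1$ is a 5-cycle, each $w_i$ is adjacent exactly to $v_{i-1},v_{i+1}$ (indices mod 5) and $z$, and there are no other edges. The Clebsch graph $F_2$ is the graph with vertex set $\mathbb{Z}_2^4$ in which $x\sim y$ iff $x+y\in\{e_1,e_2,e_3,e_4,(1,1,1,1)\}$ (a 5-regular triangle-free graph on 16 vertices). -}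

module Defs where

open import Data.Nat using (ℕ; zero; suc; _≡ᵇ_; ⌊_/2⌋)
open import Data.Fin using (Fin; toℕ; _≟_)
open import Data.Fin.Properties using (toℕ-injective)
open import Data.Bool using (Bool; true; false; _∧_; _∨_; not; if_then_else_)
open import Data.Bool.Properties using (∨-comm)
open import Data.List using (List; []; _∷_)
open import Data.Bool.ListAction using (any)
open import Data.Product using (Σ; ∃; ∃-syntax; _×_; _,_)
open import Relation.Nullary using (¬_; does; yes; no)
open import Relation.Binary.PropositionalEquality using (_≡_; refl; _≢_; cong)
open import Function.Definitions using (Injective)

record Graph : Set where
  field
    n      : ℕ
    E      : Fin n → Fin n → Bool
    sym    : ∀ i j → E i j ≡ E j i
    irrefl : ∀ i → E i i ≡ false

open Graph public

V : Graph → Set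
V G = Fin (n G)

Adj : (G : Graph) → V G → V G → Set
Adj G u v = E G u v ≡ true

record InducedEmbedding (H G : Graph) : Set where
  field
    f         : V H → V G
    injective : Injective _≡_ _≡_ f
    preserves : ∀ i j → E H i j ≡ E G (f i) (f j)

_↪ᵢ_ : Graph → Graph → Set
H ↪ᵢ G = InducedEmbedding H G

data Reach (G : Graph) : V G → V G → Set where
  here : ∀ {u} → Reach G u u
  step : ∀ {u v w} → Adj G u v → Reach G v w → Reach G u w

Connected : Graph → Set
Connected G = ∀ u v → Reach G u v

NbhdSubset : (G : Graph) → V G → V G → Set
NbhdSubset G u v = ∀ w → Adj G u w → Adj G v w

HasComparablePair : Graph → Set
HasComparablePair G =
  ∃[ u ] ∃[ v ] (u ≢ v × ¬ Adj G u v × NbhdSubset G u v)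

ProperColouring : (G : Graph) (k : ℕ) → (V G → Fin k) → Set
ProperColouring G k c = ∀ u v → Adj G u v → c u ≢ c v

χ≤ : Graph → ℕ → Set
χ≤ G k = Σ (V G → Fin k) (ProperColouring G k)

private
  ≟-refl : ∀ {m} (i : Fin m) → does (i ≟ i) ≡ true
  ≟-refl i with i ≟ i
  ... | yes _ = refl
  ... | no ¬p = Data.Empty.⊥-elim (¬p refl)
    where import Data.Empty

  ≟-sym : ∀ {m} (i j : Fin m) → does (i ≟ j) ≡ does (j ≟ i)
  ≟-sym i j with i ≟ j | j ≟ i
  ... | yes _ | yes _ = refl
  ... | no _  | no _  = refl
  ... | yes p | no ¬q = Data.Empty.⊥-elim (¬q (Relation.Binary.PropositionalEquality.sym p))
    where import Data.Empty
  ... | no ¬p | yes q = Data.Empty.⊥-elim (¬p (Relation.Binary.PropositionalEquality.sym q))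
    where import Data.Empty

mkGraph : (m : ℕ) → (ℕ → ℕ → Bool) → Graph
mkGraph m D = record
  { n = m
  ; E = Em
  ; sym = λ i j → symm i j
  ; irrefl = λ i → irr i
  }
  where
  Em : Fin m → Fin m → Bool
  Em i j = not (does (i ≟ j)) ∧ (D (toℕ i) (toℕ j) ∨ D (toℕ j) (toℕ i))
  symm : ∀ i j → Em i j ≡ Em j i
  symm i j rewrite ≟-sym i j | ∨-comm (D (toℕ i) (toℕ j)) (D (toℕ j) (toℕ i)) = refl
  irr : ∀ i → Em i i ≡ false
  irr i rewrite ≟-refl i = refl

-- membership of an (unordered, listed once) pair in an edge list
inEdges : List (ℕ × ℕ) → ℕ → ℕ → Bool
inEdges es a b = any (λ { (x , y) → (x ≡ᵇ a) ∧ (y ≡ᵇ b) }) es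

fromEdges : (m : ℕ) → List (ℕ × ℕ) → Graph
fromEdges m es = mkGraph m (inEdges es)

C3 : Graph
C3 = fromEdges 3 ((0 , 1) ∷ (1 , 2) ∷ (2 , 0) ∷ [])

P2∪P4 : Graph
P2∪P4 = fromEdges 6 ((0 , 1) ∷ (2 , 3) ∷ (3 , 4) ∷ (4 , 5) ∷ [])

-- Mycielski–Grötzsch graph F₁:
-- code 0..4 = v₁..v₅, 5..9 = w₁..w₅, 10 = z.
-- v-cycle v₁v₂v₃v₄v₅v₁; wᵢ ~ v_{i-1}, v_{i+1}, z (indices mod 5).
F1 : Graph
F1 = fromEdges 11
  ( (0 , 1) ∷ (1 , 2) ∷ (2 , 3) ∷ (3 , 4) ∷ (4 , 0)
  ∷ (5 , 4) ∷ (5 , 1)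
  ∷ (6 , 0) ∷ (6 , 2)
  ∷ (7 , 1) ∷ (7 , 3)
  ∷ (8 , 2) ∷ (8 , 4)
  ∷ (9 , 3) ∷ (9 , 0)
  ∷ (5 , 10) ∷ (6 , 10) ∷ (7 , 10) ∷ (8 , 10) ∷ (9 , 10)
  ∷ [] )

-- Clebsch graph F₂: vertex code x ∈ {0..15} is the vector of its 4 binary
-- digits in ℤ₂⁴; x ~ y iff x + y ∈ {e₁,e₂,e₃,e₄,(1,1,1,1)}, i.e. the two
-- codes differ in exactly one bit or in all four bits.
odd? : ℕ → Bool
odd? zero = false
odd? (suc k) = not (odd? k)

bit : ℕ → ℕ → Bool
bit zero x = odd? x
bit (suc k) x = bit k ⌊ x /2⌋

xor : Bool → Bool → Bool
xor a b = if a then not b else b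

b2n : Bool → ℕ
b2n true = 1
b2n false = 0

hamming4 : ℕ → ℕ → ℕ
hamming4 x y =
  b2n (xor (bit 0 x) (bit 0 y)) Data.Nat.+ b2n (xor (bit 1 x) (bit 1 y)) Data.Nat.+
  b2n (xor (bit 2 x) (bit 2 y)) Data.Nat.+ b2n (xor (bit 3 x) (bit 3 y))
  where import Data.Nat

clebschAdj : ℕ → ℕ → Bool
clebschAdj x y = (hamming4 x y ≡ᵇ 1) ∨ (hamming4 x y ≡ᵇ 4)

F2 : Graph
F2 = mkGraph 16 clebschAdj

{-# OPTIONS --safe #-}

-- Fix a vertex z with a neighbour. If G − N(z) is bipartite, two colours for it and a third for
-- the independent set N(z) suffice. Otherwise some induced C₅ is anticomplete to z (C₇ leaves no
-- room for a neighbour of z, and longer odd cycles contain P₂ ∪ P₄). A neighbour of z then turns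
-- it into X 7: a C₅ with a twin of one of its vertices and the pendant z on that twin. Through
-- the chain X 7 ⊂ … ⊂ X 11, each time either the next graph (or F₁) occurs, or colouring every
-- vertex according to its neighbours in the current one is proper, since two adjacent vertices of
-- equal colour would create a C₃ or P₂ ∪ P₄.
-- Once F₁ occurs, excluding C₃ and P₂ ∪ P₄ leaves a vertex exactly 17 possible neighbourhoods in
-- F₁: the empty one and those of the 16 vertices of the Clebsch graph around an F₁ in it.
-- Moreover the neighbourhoods of two vertices in F₁ determine whether they are adjacent, so
-- without comparable pairs no vertex has the empty one and no two vertices share one.
module Submission where

open import Defs
open import Data.Bool using (Bool; true; false; _∧_; _∨_; not; if_then_else_) renaming (_xor_ to _xorᵇ_)
open import Data.Bool.ListAction using (any; all; or)
open import Data.Bool.Properties using (∧-comm; ∧-identityʳ; not-involutive; not-distribˡ-xor; xor-comm; T?; T-≡) renaming (_≟_ to _≟ᵇ_)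
open import Data.Empty using (⊥; ⊥-elim)
open import Data.Fin using (Fin; zero; suc; #_; _≟_)
open import Data.Fin.Properties using (all?; any?)
open import Data.List using (List; []; _∷_; map; zip; zipWith; filterᵇ; allFin; _ʳ++_; _++_; cartesianProduct)
open import Data.List.Membership.Propositional using (_∈_)
open import Data.List.Membership.Propositional.Properties using (∈-allFin; ∈-map⁺; ∈-++⁺ˡ; ∈-++⁺ʳ; ∈-filter⁺; ∈-cartesianProduct⁺)
open import Data.List.Properties using (map-∘; map-cong; ∷-injective)
open import Data.List.Relation.Unary.All using (All; []; _∷_) renaming (lookup to All-lookup; map to All-map)
open import Data.List.Relation.Unary.All.Properties using () renaming (map⁺ to All-map⁺)
open import Data.List.Relation.Unary.Any using (here; there)
open import Data.List.Relation.Unary.Any.Properties using (reverse⁺)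
open import Data.Nat using (ℕ; zero; suc)
open import Data.Product using (Σ; ∃; _×_; _,_; proj₁; proj₂)
open import Data.Sum using (_⊎_; inj₁; inj₂; [_,_]′)
open import Function using (id; _∘_)
open import Function.Bundles using (Equivalence)
open import Relation.Binary.PropositionalEquality using (_≡_; _≢_; refl; trans; cong; cong₂; subst) renaming (sym to ≡-sym)
open import Relation.Nullary using (¬_; Dec; yes; no; does)
open import Relation.Nullary.Decidable using (True; toWitness; _→-dec_; dec-true)
import Data.List.Membership.DecPropositional as DecMembership

-- Copies of graphs and finite case distinctions

-- Injectivity is left out, so the search below may pick a vertex twice. For graphs whose vertices
-- have distinct neighbourhoods it follows from preservation of adjacency.
Copy : Graph → Graph → Set
Copy P G = Σ (V P → V G) λ f → ∀ i j → E P i j ≡ E G (f i) (f j)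

PointDetermining : Graph → Set
PointDetermining P = ∀ i j → (∀ k → E P i k ≡ E P j k) → i ≡ j

pointDetermining? : ∀ P → Dec (PointDetermining P)
pointDetermining? P = all? λ i → all? λ j → all? (λ k → E P i k ≟ᵇ E P j k) →-dec (i ≟ j)

copy⇒embedding : ∀ {P G} → PointDetermining P → Copy P G → P ↪ᵢ G
copy⇒embedding {P} {G} det (f , pres) = record
  { f = f
  ; injective = λ {i} {j} fi≡fj → det i j λ k →
      trans (pres i k) (trans (cong (λ v → E G v (f k)) fi≡fj) (≡-sym (pres j k)))
  ; preserves = pres
  }

-- Lets a check of finitely many vertices escape to an alternative conclusion `R`, such as a
-- comparable pair.
forAll : ∀ {m} {P : Fin m → Set} {R : Set} → (∀ i → P i ⊎ R) → (∀ i → P i) ⊎ R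
forAll {zero}  h = inj₁ λ ()
forAll {suc m} h with h zero | forAll (h ∘ suc)
... | inj₂ r | _       = inj₂ r
... | inj₁ _ | inj₂ r  = inj₂ r
... | inj₁ p | inj₁ ps = inj₁ λ { zero → p ; (suc i) → ps i }

forAll₂ : ∀ {m} {P : Fin m → Fin m → Set} {R : Set} → (∀ i j → P i j ⊎ R) → (∀ i j → P i j) ⊎ R
forAll₂ h = forAll λ i → forAll (h i)

on : ∀ {R : Set} (b : Bool) → (b ≡ true → R) → (b ≡ false → R) → R
on true  t f = t refl
on false t f = f refl

true≢false : ∀ {R : Set} {b} → b ≡ true → b ≡ false → R
true≢false refl ()

∧-true : ∀ {a b} → a ∧ b ≡ true → a ≡ true × b ≡ true
∧-true {true} eq = refl , eq

∨-true : ∀ {a b} → a ∨ b ≡ true → a ≡ true ⊎ b ≡ true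
∨-true {true}  eq = inj₁ refl
∨-true {false} eq = inj₂ eq

any-map⁻ : ∀ {A B : Set} {p : B → Bool} (g : A → B) xs → any p (map g xs) ≡ true → ∃ λ x → x ∈ xs × p (g x) ≡ true
any-map⁻ {p = p} g (x ∷ xs) eq with ∨-true {p (g x)} eq
... | inj₁ px  = x , here refl , px
... | inj₂ pxs with any-map⁻ g xs pxs
...   | y , y∈ , py = y , there y∈ , py

all-∈ : ∀ {A : Set} {p : A → Bool} {xs x} → all p xs ≡ true → x ∈ xs → p x ≡ true
all-∈ eq (here refl) = proj₁ (∧-true eq)
all-∈ {p = p} {y ∷ _} eq (there x∈) = all-∈ (proj₂ (∧-true {p y} eq)) x∈

-- Searching for copies of a graph

Matrix : Set
Matrix = List (List Bool)

_==_ : List Bool → List Bool → Bool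
[]           == []           = true
(true ∷ as)  == (true ∷ bs)  = as == bs
(false ∷ as) == (false ∷ bs) = as == bs
_            == _            = false

==-sound : ∀ as bs → as == bs ≡ true → as ≡ bs
==-sound []           []           eq = refl
==-sound (true ∷ as)  (true ∷ bs)  eq = cong (true ∷_) (==-sound as bs eq)
==-sound (false ∷ as) (false ∷ bs) eq = cong (false ∷_) (==-sound as bs eq)
==-sound []           (_ ∷ _)      ()
==-sound (true ∷ _)   []           ()
==-sound (true ∷ _)   (false ∷ _)  ()
==-sound (false ∷ _)  []           ()
==-sound (false ∷ _)  (true ∷ _)   ()

-- M is the adjacency matrix of a host ρ, and the i-th signature lists the adjacencies of ρᵢ to
-- the vertices placed so far; each wanted row is the signature required of the next vertex.
find : Matrix → Matrix → Matrix → Bool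
find M []       sigs = true
find M (w ∷ ws) sigs = any (λ { (r , s) → s == w ∧ find M ws (zipWith _∷_ r sigs) }) (zip M sigs)

plan : (P : Graph) → List (V P) → List (V P) → Matrix
plan P placed []         = []
plan P placed (p ∷ todo) = map (E P p) placed ∷ plan P (p ∷ placed) todo

record Probe : Set where
  constructor mkProbe
  field
    shape : Graph
    placed   : List (V shape)
    todo     : List (V shape)
    covers   : ∀ i → i ∈ todo ʳ++ placed

open Probe

probe : (P : Graph) (placed todo : List (V P)) →
  {True (all? λ i → DecMembership._∈?_ _≟_ i (todo ʳ++ placed))} → Probe
probe P placed todo {ok} = mkProbe P placed todo (toWitness ok)

wholeProbe : Graph → Probe
wholeProbe P = mkProbe P [] (allFin (n P)) λ i → reverse⁺ (∈-allFin i)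

wanted : Probe → Matrix
wanted pr = plan (shape pr) (placed pr) (todo pr)

found : List Matrix → Matrix → Matrix → Bool
found ws M sigs = any (λ w → find M w sigs) ws

blank : Matrix → Matrix
blank = map (λ _ → [])

_▹_ : Matrix → List Bool → Matrix
M ▹ T = (false ∷ T) ∷ zipWith _∷_ T M

rows : Graph → Matrix
rows H = map (λ i → map (E H i) (allFin (n H))) (allFin (n H))

-- The argument only supplies a length, so `bools M` enumerates every conceivable trace on the host
-- with matrix `M`.
bools : ∀ {A : Set} → List A → List (List Bool)
bools []       = [] ∷ []
bools (_ ∷ as) = map (false ∷_) (bools as) ++ map (true ∷_) (bools as)

map-∈-bools : ∀ {A B : Set} (f : A → Bool) (g : A → B) xs → map f xs ∈ bools (map g xs)
map-∈-bools f g []       = here refl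
map-∈-bools f g (x ∷ xs) with f x
... | false = ∈-++⁺ˡ (∈-map⁺ (false ∷_) (map-∈-bools f g xs))
... | true  = ∈-++⁺ʳ (map (false ∷_) (bools (map g xs))) (∈-map⁺ (true ∷_) (map-∈-bools f g xs))

-- Up to automorphism, these are all the places of a vertex, of an adjacent and of a nonadjacent
-- ordered pair of vertices in C₃ and P₂ ∪ P₄.
oneVertex : List Probe
oneVertex
  = probe C3 (# 0 ∷ []) (# 1 ∷ # 2 ∷ [])
  ∷ probe P2∪P4 (# 0 ∷ []) (# 1 ∷ # 2 ∷ # 3 ∷ # 4 ∷ # 5 ∷ [])
  ∷ probe P2∪P4 (# 2 ∷ []) (# 3 ∷ # 4 ∷ # 5 ∷ # 0 ∷ # 1 ∷ [])
  ∷ probe P2∪P4 (# 3 ∷ []) (# 2 ∷ # 4 ∷ # 5 ∷ # 0 ∷ # 1 ∷ [])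
  ∷ []

adjacentPair : List Probe
adjacentPair
  = probe C3 (# 1 ∷ # 0 ∷ []) (# 2 ∷ [])
  ∷ probe P2∪P4 (# 1 ∷ # 0 ∷ []) (# 2 ∷ # 3 ∷ # 4 ∷ # 5 ∷ [])
  ∷ probe P2∪P4 (# 3 ∷ # 2 ∷ []) (# 4 ∷ # 5 ∷ # 0 ∷ # 1 ∷ [])
  ∷ probe P2∪P4 (# 2 ∷ # 3 ∷ []) (# 4 ∷ # 5 ∷ # 0 ∷ # 1 ∷ [])
  ∷ probe P2∪P4 (# 4 ∷ # 3 ∷ []) (# 2 ∷ # 5 ∷ # 0 ∷ # 1 ∷ [])
  ∷ []

nonadjacentPair : List Probe
nonadjacentPair
  = probe P2∪P4 (# 2 ∷ # 0 ∷ []) (# 1 ∷ # 3 ∷ # 4 ∷ # 5 ∷ [])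
  ∷ probe P2∪P4 (# 0 ∷ # 2 ∷ []) (# 1 ∷ # 3 ∷ # 4 ∷ # 5 ∷ [])
  ∷ probe P2∪P4 (# 3 ∷ # 0 ∷ []) (# 1 ∷ # 2 ∷ # 4 ∷ # 5 ∷ [])
  ∷ probe P2∪P4 (# 0 ∷ # 3 ∷ []) (# 1 ∷ # 2 ∷ # 4 ∷ # 5 ∷ [])
  ∷ probe P2∪P4 (# 4 ∷ # 2 ∷ []) (# 3 ∷ # 5 ∷ # 0 ∷ # 1 ∷ [])
  ∷ probe P2∪P4 (# 2 ∷ # 4 ∷ []) (# 3 ∷ # 5 ∷ # 0 ∷ # 1 ∷ [])
  ∷ probe P2∪P4 (# 5 ∷ # 2 ∷ []) (# 3 ∷ # 4 ∷ # 0 ∷ # 1 ∷ [])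
  ∷ []

-- Admissible traces of vertices on a host

-- The two ways to discard a trace `S`: a forbidden graph through the new vertex with all other
-- vertices in the host, or a goal graph in the host enlarged by that vertex.
bad₁ : List Matrix → List Matrix → Matrix → List Bool → Bool
bad₁ one goals M S =
  found one M (zipWith _∷_ S (blank M)) ∨ found goals (M ▹ S) (blank (M ▹ S))

bad₂ : List Matrix → List Matrix → Matrix → Bool → List Bool → List Bool → Bool
bad₂ two goals M b S T =
  found two M (zipWith _∷_ T (zipWith _∷_ S (blank M)))
    ∨ found goals ((M ▹ S) ▹ (b ∷ T)) (blank ((M ▹ S) ▹ (b ∷ T)))

traces : List Matrix → List Matrix → Matrix → List (List Bool)
traces one goals M = filterᵇ (λ S → not (bad₁ one goals M S)) (bools M)

goalPlans : List Graph → List Matrix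
goalPlans = map (wanted ∘ wholeProbe)

hostTraces : List Graph → Matrix → List (List Bool)
hostTraces goals M = traces (map wanted oneVertex) (goalPlans goals) M

module _ {c : ℕ} (colour : List Bool → Fin c) where

  -- If two surviving traces of equal colour cannot belong to adjacent vertices, colouring every
  -- vertex by its trace is proper.
  separates : List Matrix → List Matrix → Matrix → List (List Bool) → Bool
  separates two goals M Ts =
    all (λ S → all (λ T → not (does (colour S ≟ colour T)) ∨ bad₂ two goals M true S T) Ts) Ts

  colours : List Graph → Matrix → Bool
  colours goals M = separates (map wanted adjacentPair) (goalPlans goals) M (hostTraces goals M)

module _ (predict : List Bool → List Bool → Bool) where

  -- The prediction is confirmed by refuting its opposite: nonadjacency where adjacency is
  -- predicted, and conversely.
  forces : List Matrix → List Matrix → Matrix → List (List Bool) → Bool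
  forces adj non M Ts =
    all (λ S → all (λ T → if predict S T then bad₂ non [] M false S T else bad₂ adj [] M true S T) Ts) Ts

  predicts : Matrix → Bool
  predicts M = forces (map wanted adjacentPair) (map wanted nonadjacentPair) M (hostTraces [] M)

-- The chain of hosts and its 3-colourings

-- The pendant z of X 7 is vertex 6; each of its neighbours 5, 7, 8, 9 has two
-- neighbours on the 5-cycle 0 … 4. A fifth such neighbour would complete X 10 to F₁.
X11-edges : List (ℕ × ℕ)
X11-edges
  = (0 , 1) ∷ (1 , 2) ∷ (2 , 3) ∷ (3 , 4) ∷ (4 , 0)
  ∷ (5 , 1) ∷ (5 , 4) ∷ (6 , 5)
  ∷ (7 , 1) ∷ (7 , 3) ∷ (7 , 6)
  ∷ (8 , 0) ∷ (8 , 3) ∷ (8 , 6)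
  ∷ (9 , 0) ∷ (9 , 2) ∷ (9 , 6)
  ∷ (10 , 0) ∷ (10 , 7)
  ∷ []

-- fromEdges ignores the edges that leave the first k vertices.
X : ℕ → Graph
X k = fromEdges k X11-edges

nth : List Bool → ℕ → Bool
nth []       _       = false
nth (b ∷ bs) zero    = b
nth (b ∷ bs) (suc i) = nth bs i

-- Rules are tried in order. A rule with an empty list always applies and so sets the default;
-- without one the default is colour 0.
firstAvoided : List (List ℕ × Fin 3) → List Bool → Fin 3
firstAvoided []             S = # 0
firstAvoided ((is , c) ∷ l) S = if any (nth S) is then firstAvoided l S else c

-- A few nonadjacencies to the host split the traces into three classes; the evaluations below
-- verify that adjacency within a class forces a forbidden graph or a goal. The last clause serves
-- `X 11`.
colour : ℕ → List Bool → Fin 3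
colour 7  = firstAvoided ((1 ∷ 2 ∷ 3 ∷ [] , # 0) ∷ (1 ∷ 4 ∷ [] , # 1) ∷ (1 ∷ [] , # 0) ∷ ([] , # 2) ∷ [])
colour 8  = firstAvoided ((1 ∷ 5 ∷ [] , # 2) ∷ (1 ∷ [] , # 1) ∷ [])
colour 9  = firstAvoided ((1 ∷ 3 ∷ [] , # 2) ∷ (1 ∷ [] , # 1) ∷ [])
colour 10 = firstAvoided ((2 ∷ 5 ∷ 7 ∷ 8 ∷ [] , # 2) ∷ (4 ∷ 9 ∷ [] , # 1) ∷ [])
colour _  = firstAvoided ((0 ∷ 1 ∷ [] , # 2) ∷ (0 ∷ [] , # 1) ∷ [])

X11-colours : colours (colour 11) (F1 ∷ []) (rows (X 11)) ≡ true
X11-colours = refl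

X10-colours : colours (colour 10) (X 11 ∷ F1 ∷ []) (rows (X 10)) ≡ true
X10-colours = refl

X9-colours : colours (colour 9) (X 10 ∷ []) (rows (X 9)) ≡ true
X9-colours = refl

X8-colours : colours (colour 8) (X 9 ∷ []) (rows (X 8)) ≡ true
X8-colours = refl

X7-colours : colours (colour 7) (X 8 ∷ []) (rows (X 7)) ≡ true
X7-colours = refl

-- Odd cycles away from a vertex

C5 C7 : Graph
C5 = fromEdges 5 ((0 , 1) ∷ (1 , 2) ∷ (2 , 3) ∷ (3 , 4) ∷ (4 , 0) ∷ [])
C7 = fromEdges 7 ((0 , 1) ∷ (1 , 2) ∷ (2 , 3) ∷ (3 , 4) ∷ (4 , 5) ∷ (5 , 6) ∷ (6 , 0) ∷ [])

-- H with an isolated vertex put in front.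
beyond : Graph → Matrix
beyond H = rows H ▹ map (λ _ → false) (allFin (n H))

-- Applied to `beyond H`, it says that a neighbour of the isolated front vertex cannot occur without
-- a forbidden graph or a goal.
avoidsFirst : List Graph → Matrix → Bool
avoidsFirst goals M = all (λ S → not (nth S 0)) (hostTraces goals M)

-- A neighbour of `z` with at most one neighbour on the cycle leaves a P₄ there, apart from the edge
-- to `z`. Without triangles it therefore has exactly two, nonadjacent, neighbours on the cycle,
-- which gives `X 7`.
C5-beyond : avoidsFirst (X 7 ∷ []) (beyond C5) ≡ true
C5-beyond = refl

C7-beyond : avoidsFirst [] (beyond C7) ≡ true
C7-beyond = refl

-- The Clebsch graph around F₁

-- Images of v₁ to v₅, w₁ to w₅ and z, in this order, under an induced embedding. The 5-cycle is 0,
-- 1, 3, 7, 8, where 7 and 8 differ in all four bits.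
F1⇒F2 : List (V F2)
F1⇒F2 = # 0 ∷ # 1 ∷ # 3 ∷ # 7 ∷ # 8 ∷ # 9 ∷ # 2 ∷ # 5 ∷ # 12 ∷ # 15 ∷ # 13 ∷ []

-- The Clebsch vertex with the given neighbours among the images of F1 (junk value 0 if none).
code : List Bool → V F2
code S = first (allFin 16)
  where
  first : List (V F2) → V F2
  first []       = # 0
  first (c ∷ cs) = if map (E F2 c) F1⇒F2 == S then c else first cs

-- The all-false trace corresponds to no Clebsch vertex; the two factors `or` predict that a vertex
-- with this trace is isolated.
clebsch : List Bool → List Bool → Bool
clebsch S T = or S ∧ or T ∧ E F2 (code S) (code T)

F1-predicts : predicts clebsch (rows F1) ≡ true
F1-predicts = refl

-- Soundness of the search in a graph

module Host (G : Graph) where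

  trace : V G → List (V G) → List Bool
  trace u σ = map (E G u) σ

  adjacency : List (V G) → List (V G) → Matrix
  adjacency σ ρ = map (λ u → trace u σ) ρ

  adjacency-∷ : ∀ v σ ρ → zipWith _∷_ (trace v ρ) (adjacency σ ρ) ≡ adjacency (v ∷ σ) ρ
  adjacency-∷ v σ []      = refl
  adjacency-∷ v σ (u ∷ ρ) = cong₂ _∷_ (cong (_∷ trace u σ) (Graph.sym G v u)) (adjacency-∷ v σ ρ)

  adjacency-▹ : ∀ v ρ → adjacency ρ ρ ▹ trace v ρ ≡ adjacency (v ∷ ρ) (v ∷ ρ)
  adjacency-▹ v ρ = cong₂ _∷_ (cong (_∷ trace v ρ) (≡-sym (irrefl G v))) (adjacency-∷ v ρ ρ)

  blank-adjacency : ∀ σ ρ → blank (adjacency σ ρ) ≡ adjacency [] ρ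
  blank-adjacency σ ρ = ≡-sym (map-∘ ρ)

  rows-copy : ∀ {H} ((f , _) : Copy H G) → rows H ≡ adjacency (map f (allFin (n H))) (map f (allFin (n H)))
  rows-copy {H} (f , pres) =
    trans (map-cong (λ i → trans (map-cong (pres i) is) (map-∘ is)) is) (map-∘ is)
    where
    is : List (V H)
    is = allFin (n H)

  -- A partial copy, newest vertex first: each entry agrees with all earlier ones, and symmetry and
  -- irreflexivity supply the remaining adjacencies.
  data Match (P : Graph) : List (V P) → List (V G) → Set where
    []  : Match P [] []
    _∷_ : ∀ {p ps v σ} → map (E P p) ps ≡ trace v σ → Match P ps σ → Match P (p ∷ ps) (v ∷ σ)

  image : ∀ {P ps σ i} → Match P ps σ → i ∈ ps → V G
  image (_∷_ {v = v} _ _) (here _)  = v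
  image (_ ∷ m)           (there i) = image m i

  entry : ∀ {P ps σ v p q} (m : Match P ps σ) → map (E P p) ps ≡ trace v σ → (q∈ : q ∈ ps) →
    E P p q ≡ E G v (image m q∈)
  entry (_ ∷ m) eq (here refl) = proj₁ (∷-injective eq)
  entry (_ ∷ m) eq (there q∈)  = entry m (proj₂ (∷-injective eq)) q∈

  image-preserves : ∀ {P ps σ i j} (m : Match P ps σ) (i∈ : i ∈ ps) (j∈ : j ∈ ps) →
    E P i j ≡ E G (image m i∈) (image m j∈)
  image-preserves {P} (_∷_ {v = v} eq m) (here refl) (here refl) = trans (irrefl P _) (≡-sym (irrefl G v))
  image-preserves     (eq ∷ m) (here refl) (there j∈)  = entry m eq j∈
  image-preserves {P} (_∷_ {v = v} eq m) (there i∈)  (here refl) =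
    trans (Graph.sym P _ _) (trans (entry m eq i∈) (Graph.sym G v _))
  image-preserves     (eq ∷ m) (there i∈)  (there j∈)  = image-preserves m i∈ j∈

  match⇒copy : ∀ {P ps σ} → (∀ i → i ∈ ps) → Match P ps σ → Copy P G
  match⇒copy covers m = (λ i → image m (covers i)) , λ i j → image-preserves m (covers i) (covers j)

  any-zip⁻ : ∀ {p σ τ} ρ → any p (zip (adjacency σ ρ) (adjacency τ ρ)) ≡ true → ∃ λ u → p (trace u σ , trace u τ) ≡ true
  any-zip⁻ {p} {σ} {τ} (u ∷ ρ) eq = [ (λ hit → u , hit) , any-zip⁻ ρ ]′ (∨-true {p (trace u σ , trace u τ)} eq)

  find-sound : ∀ {P} todo {ps σ} ρ → Match P ps σ →
    find (adjacency ρ ρ) (plan P ps todo) (adjacency σ ρ) ≡ true → ∃ (Match P (todo ʳ++ ps))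
  find-sound []             ρ m _  = _ , m
  find-sound {P} (p ∷ todo) {ps} {σ} ρ m eq
    with any-zip⁻ ρ eq
  ... | u , eq′ with ∧-true {trace u σ == map (E P p) ps} eq′
  ...   | row , rest = find-sound todo ρ (≡-sym (==-sound _ _ row) ∷ m)
                         (subst (λ S → find (adjacency ρ ρ) (plan P (p ∷ ps) todo) S ≡ true) (adjacency-∷ u σ ρ) rest)

  -- `R` is whatever a copy leads to: a contradiction in the Clebsch argument, the desired outcome
  -- in the colouring chain.
  Excludes : List (V G) → Set → Probe → Set
  Excludes σ R pr = Match (shape pr) (placed pr) σ × (Copy (shape pr) G → R)

  found-sound : ∀ {R σ M sigs} ρ prs → M ≡ adjacency ρ ρ → sigs ≡ adjacency σ ρ → All (Excludes σ R) prs →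
    found (map wanted prs) M sigs ≡ true → R
  found-sound ρ prs refl refl ex eq with any-map⁻ wanted prs eq
  ... | pr , pr∈ , hit with All-lookup ex pr∈
  ...   | m , handle = handle (match⇒copy (covers pr) (proj₂ (find-sound (todo pr) ρ m hit)))

  module _ {R : Set} (noC3 : Copy C3 G → R) (noP2∪P4 : Copy P2∪P4 G → R) where

    module _ (goals : List Graph) (onGoals : All (λ P → Copy P G → R) goals)
             {M : Matrix} (ρ : List (V G)) (M≡ : M ≡ adjacency ρ ρ) where

      goals-sound : ∀ {M′} ρ′ → M′ ≡ adjacency ρ′ ρ′ → found (goalPlans goals) M′ (blank M′) ≡ true → R
      goals-sound ρ′ refl eq =
        found-sound ρ′ (map wholeProbe goals) refl (blank-adjacency ρ′ ρ′) (All-map⁺ (All-map ([] ,_) onGoals))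
          (subst (λ ws → found ws (adjacency ρ′ ρ′) (blank (adjacency ρ′ ρ′)) ≡ true) (map-∘ goals) eq)

      ▹-trace : ∀ x → M ▹ trace x ρ ≡ adjacency (x ∷ ρ) (x ∷ ρ)
      ▹-trace x = trans (cong (_▹ trace x ρ) M≡) (adjacency-▹ x ρ)

      ▹▹-trace : ∀ x y {b} → E G y x ≡ b → (M ▹ trace x ρ) ▹ (b ∷ trace y ρ) ≡ adjacency (y ∷ x ∷ ρ) (y ∷ x ∷ ρ)
      ▹▹-trace x y refl = trans (cong (_▹ trace y (x ∷ ρ)) (▹-trace x)) (adjacency-▹ y (x ∷ ρ))

      sigs₁ : ∀ x → zipWith _∷_ (trace x ρ) (blank M) ≡ adjacency (x ∷ []) ρ
      sigs₁ x = trans (cong (zipWith _∷_ (trace x ρ)) (trans (cong blank M≡) (blank-adjacency ρ ρ))) (adjacency-∷ x [] ρ)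

      sigs₂ : ∀ x y → zipWith _∷_ (trace y ρ) (zipWith _∷_ (trace x ρ) (blank M)) ≡ adjacency (y ∷ x ∷ []) ρ
      sigs₂ x y = trans (cong (zipWith _∷_ (trace y ρ)) (sigs₁ x)) (adjacency-∷ y (x ∷ []) ρ)

      bad₁-sound : ∀ x → bad₁ (map wanted oneVertex) (goalPlans goals) M (trace x ρ) ≡ true → R
      bad₁-sound x eq = [ found-sound ρ oneVertex M≡ (sigs₁ x) excluded , goals-sound (x ∷ ρ) (▹-trace x) ]′
                          (∨-true {found (map wanted oneVertex) M (zipWith _∷_ (trace x ρ) (blank M))} eq)
        where
        excluded : All (Excludes (x ∷ []) R) oneVertex
        excluded = (refl ∷ [] , noC3) ∷ (refl ∷ [] , noP2∪P4) ∷ (refl ∷ [] , noP2∪P4) ∷ (refl ∷ [] , noP2∪P4) ∷ []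

      bad₂-sound : ∀ x y {b} prs → E G y x ≡ b → All (Excludes (y ∷ x ∷ []) R) prs →
        bad₂ (map wanted prs) (goalPlans goals) M b (trace x ρ) (trace y ρ) ≡ true → R
      bad₂-sound x y prs b≡ ex eq =
        [ found-sound ρ prs M≡ (sigs₂ x y) ex , goals-sound (y ∷ x ∷ ρ) (▹▹-trace x y b≡) ]′
          (∨-true {found (map wanted prs) M (zipWith _∷_ (trace y ρ) (zipWith _∷_ (trace x ρ) (blank M)))} eq)

      adjacent-sound : ∀ x y → E G y x ≡ true →
        bad₂ (map wanted adjacentPair) (goalPlans goals) M true (trace x ρ) (trace y ρ) ≡ true → R
      adjacent-sound x y yx = bad₂-sound x y adjacentPair yx
        ((m refl , noC3) ∷ (m refl , noP2∪P4) ∷ (m refl , noP2∪P4) ∷ (m refl , noP2∪P4) ∷ (m refl , noP2∪P4) ∷ [])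
        where
        m : ∀ {P p q} → E P q p ≡ true → Match P (q ∷ p ∷ []) (y ∷ x ∷ [])
        m qp = cong (_∷ []) (trans qp (≡-sym yx)) ∷ refl ∷ []

      nonadjacent-sound : ∀ x y → E G y x ≡ false →
        bad₂ (map wanted nonadjacentPair) (goalPlans goals) M false (trace x ρ) (trace y ρ) ≡ true → R
      nonadjacent-sound x y yx = bad₂-sound x y nonadjacentPair yx
        ((m refl , noP2∪P4) ∷ (m refl , noP2∪P4) ∷ (m refl , noP2∪P4) ∷ (m refl , noP2∪P4) ∷ (m refl , noP2∪P4) ∷ (m refl , noP2∪P4) ∷ (m refl , noP2∪P4) ∷ [])
        where
        m : ∀ {P p q} → E P q p ≡ false → Match P (q ∷ p ∷ []) (y ∷ x ∷ [])
        m qp = cong (_∷ []) (trans qp (≡-sym yx)) ∷ refl ∷ []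

      trace∈hostTraces : ∀ x → trace x ρ ∈ hostTraces goals M ⊎ R
      trace∈hostTraces x = on (bad₁ (map wanted oneVertex) (goalPlans goals) M (trace x ρ))
        (λ eq → inj₂ (bad₁-sound x eq))
        (λ eq → inj₁ (∈-filter⁺ (T? ∘ _) (subst (λ N → trace x ρ ∈ bools N) (≡-sym M≡) (map-∈-bools (E G x) _ ρ))
                        (Equivalence.from T-≡ (cong not eq))))

      colourHost : ∀ {c} (col : List Bool → Fin c) → colours col goals M ≡ true → χ≤ G c ⊎ R
      colourHost col ok with forAll trace∈hostTraces
      ... | inj₂ r  = inj₂ r
      ... | inj₁ T∈ with forAll₂ proper
        where
        proper : ∀ u v → (Adj G u v → col (trace u ρ) ≢ col (trace v ρ)) ⊎ R
        proper u v = on (E G u v)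
          (λ uv → [ (λ ne → inj₁ λ _ eq → true≢false (dec-true (col (trace u ρ) ≟ col (trace v ρ)) eq) (trans (≡-sym (not-involutive _)) (cong not ne)))
                  , inj₂ ∘ adjacent-sound u v (trans (Graph.sym G v u) uv) ]′
                    (∨-true (all-∈ (all-∈ ok (T∈ u)) (T∈ v))))
          (λ uv → inj₁ λ uv′ → true≢false uv′ uv)
      ...   | inj₂ r = inj₂ r
      ...   | inj₁ p = inj₁ ((λ u → col (trace u ρ)) , p)

      firstNonadjacent : ∀ {z} y → avoidsFirst goals M ≡ true → nth (trace y ρ) 0 ≡ E G y z → Adj G y z → R
      firstNonadjacent y ok hd yz with trace∈hostTraces y
      ... | inj₂ r  = r
      ... | inj₁ T∈ = true≢false (trans hd yz) (trans (≡-sym (not-involutive _)) (cong not (all-∈ ok T∈)))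

  -- With no goals and with `R` empty, every surviving pair of traces has the value opposite to the
  -- prediction refuted.
  predicted : (noC3 : Copy C3 G → ⊥) (noP2∪P4 : Copy P2∪P4 G → ⊥) (predict : List Bool → List Bool → Bool)
    {M : Matrix} (ρ : List (V G)) → M ≡ adjacency ρ ρ → predicts predict M ≡ true →
    ∀ u v → E G u v ≡ predict (trace u ρ) (trace v ρ)
  predicted noC3 noP2∪P4 predict {M} ρ M≡ ok u v with trace∈hostTraces noC3 noP2∪P4 [] [] ρ M≡ u | trace∈hostTraces noC3 noP2∪P4 [] [] ρ M≡ v
  ... | inj₂ () | _
  ... | inj₁ _  | inj₂ ()
  ... | inj₁ u∈ | inj₁ v∈ = compare (predict S T) (E G u v) refl refl
    where
    S T : List Bool
    S = trace u ρ
    T = trace v ρ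
    found≡ : ∀ {b} → predict S T ≡ b →
      (if b then bad₂ (map wanted nonadjacentPair) [] M false S T else bad₂ (map wanted adjacentPair) [] M true S T) ≡ true
    found≡ refl = all-∈ (all-∈ ok u∈) v∈
    compare : ∀ a b → predict S T ≡ a → E G u v ≡ b → b ≡ a
    compare true  true  _ _ = refl
    compare false false _ _ = refl
    compare true  false p e = ⊥-elim (nonadjacent-sound noC3 noP2∪P4 [] [] ρ M≡ u v (trans (Graph.sym G v u) e) (found≡ p))
    compare false true  p e = ⊥-elim (adjacent-sound noC3 noP2∪P4 [] [] ρ M≡ u v (trans (Graph.sym G v u) e) (found≡ p))

-- Bipartitions and odd closed walks

module _ (B : Graph) where

  data Walk : ℕ → V B → V B → Set where
    []  : ∀ {u} → Walk 0 u u
    _∷_ : ∀ {k u v w} → Adj B u v → Walk k v w → Walk (suc k) u w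

  Bipartite OddClosedWalk : Set
  Bipartite     = Σ (V B → Bool) λ side → ∀ u v → Adj B u v → side u ≡ not (side v)
  OddClosedWalk = ∃ λ k → ∃ λ u → odd? k ≡ true × Walk k u u

  ParityWalk : Bool → V B → V B → Set
  ParityWalk b u v = ∃ λ k → odd? k ≡ b × Walk k u v

module _ {B : Graph} where

  edge : ∀ {u v} → Adj B u v → ParityWalk B true u v
  edge uv = 1 , refl , uv ∷ []

  _++ʷ_ : ∀ {a b u v w} → ParityWalk B a u v → ParityWalk B b v w → ParityWalk B (a xorᵇ b) u w
  (_ , refl , p) ++ʷ (_ , refl , q) = append p q
    where
    append : ∀ {k l u v w} → Walk B k u v → Walk B l v w → ParityWalk B (odd? k xorᵇ odd? l) u w
    append []                 q = _ , refl , q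
    append {suc k} {l} (e ∷ p) q with append p q
    ... | m , eq , r = suc m , trans (cong not eq) (not-distribˡ-xor (odd? k) (odd? l)) , e ∷ r

  reverseʷ : ∀ {b u v} → ParityWalk B b u v → ParityWalk B b v u
  reverseʷ (_ , refl , p) = rev p
    where
    rev : ∀ {k u v} → Walk B k u v → ParityWalk B (odd? k) v u
    rev []      = 0 , refl , []
    rev {suc k} (e ∷ p) = subst (λ b → ParityWalk B b _ _) (xor-comm (odd? k) true) (rev p ++ʷ edge (trans (Graph.sym B _ _) e))

-- Union-find state: processing an edge either merges two classes or closes an odd walk.
record Rooting (B : Graph) : Set where
  field
    root : V B → V B
    side : V B → Bool
    path : ∀ v → ParityWalk B (side v) v (root v)

open Rooting

-- The invariant kept for every edge already processed.
Split : ∀ {B} → Rooting B → V B × V B → Set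
Split {B} F (u , v) = Adj B u v → root F u ≡ root F v × side F u ≡ not (side F v)

module _ {B : Graph} where

  trivialRooting : Rooting B
  trivialRooting = record { root = id ; side = λ _ → false ; path = λ v → 0 , refl , [] }

  module Merge (F : Rooting B) {u v : V B} (uv : Adj B u v) where

    -- Parity of the walk from the root of `v` through `v` and `u` to the root of `u`; all sides in
    -- the class of `v` change by it.
    flip : Bool
    flip = side F v xorᵇ (true xorᵇ side F u)

    bridge : ParityWalk B flip (root F v) (root F u)
    bridge = reverseʷ (path F v) ++ʷ (edge (trans (Graph.sym B v u) uv) ++ʷ path F u)

    merged : Rooting B
    merged = record { root = root′ ; side = side′ ; path = path′ }
      where
      root′ : V B → V B
      root′ w = if does (root F w ≟ root F v) then root F u else root F w
      side′ : V B → Bool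
      side′ w = if does (root F w ≟ root F v) then side F w xorᵇ flip else side F w
      path′ : ∀ w → ParityWalk B (side′ w) w (root′ w)
      path′ w with root F w ≟ root F v
      ... | no _   = path F w
      ... | yes eq = path F w ++ʷ subst (λ r → ParityWalk B flip r (root F u)) (≡-sym eq) bridge

    -- Both ends share a class, so `flip` acts on both sides or on neither.
    merged-old : ∀ e → Split F e → Split merged e
    merged-old (a , b) split ab with split ab
    ... | r , s rewrite r with root F b ≟ root F v
    ...   | no _  = refl , s
    ...   | yes _ = refl , trans (cong (_xorᵇ flip) s) (≡-sym (not-distribˡ-xor (side F b) flip))

    merged-new : root F u ≢ root F v → Split merged (u , v)
    merged-new ne _ with root F u ≟ root F v | root F v ≟ root F v
    ... | yes eq | _      = ⊥-elim (ne eq)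
    ... | no _   | no ne′ = ⊥-elim (ne′ refl)
    ... | no _   | yes _  = refl , flips (side F u) (side F v)
      where
      flips : ∀ a b → a ≡ not (b xorᵇ (b xorᵇ (true xorᵇ a)))
      flips true  true  = refl
      flips true  false = refl
      flips false true  = refl
      flips false false = refl

  rooting : (es : List (V B × V B)) → (Σ (Rooting B) λ F → All (Split F) es) ⊎ OddClosedWalk B
  rooting [] = inj₁ (trivialRooting , [])
  rooting ((u , v) ∷ es) with rooting es
  ... | inj₂ w         = inj₂ w
  ... | inj₁ (F , all) = on (E B u v) adjacent λ uv → inj₁ (F , (λ uv′ → true≢false uv′ uv) ∷ all)
    where
    adjacent : Adj B u v → _
    adjacent uv with root F u ≟ root F v
    ... | no ne  = inj₁ (merged , merged-new ne ∷ All-map (λ {e} → merged-old e) all)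
      where open Merge F uv
    ... | yes eq with side F u ≟ᵇ not (side F v)
    ...   | yes s  = inj₁ (F , (λ _ → eq , s) ∷ all)
    -- With equal sides, the two paths to the common root have equal parity, so together with the
    -- edge they close an odd walk.
    ...   | no ne  with edge uv ++ʷ (path F v ++ʷ subst (λ r → ParityWalk B (side F u) r u) eq (reverseʷ (path F u)))
    ...     | k , odd , w = inj₂ (k , u , trans odd (sameSide (side F u) (side F v) ne) , w)
      where
      sameSide : ∀ a b → a ≢ not b → true xorᵇ (b xorᵇ a) ≡ true
      sameSide true  true  _  = refl
      sameSide false false _  = refl
      sameSide true  false ne = ⊥-elim (ne refl)
      sameSide false true  ne = ⊥-elim (ne refl)

bipartite⊎oddClosedWalk : ∀ B → Bipartite B ⊎ OddClosedWalk B
bipartite⊎oddClosedWalk B with rooting {B} (cartesianProduct (allFin (n B)) (allFin (n B)))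
... | inj₂ w         = inj₂ w
... | inj₁ (F , all) = inj₁ (side F , λ u v uv → proj₂ (All-lookup all (∈-cartesianProduct⁺ (∈-allFin u) (∈-allFin v)) uv))

-- Induced odd cycles

-- A chord of an odd closed walk cuts off a shorter odd closed walk, so a shortest one is an
-- induced odd cycle, and from length nine on it contains P₂ ∪ P₄.
module OddCycle {B : Graph} {R : Set} (noC3 : Copy C3 B → R) (noP2∪P4 : Copy P2∪P4 B → R)
                (onC5 : Copy C5 B → R) (onC7 : Copy C7 B → R) where

  open Host B

  copy : ∀ P ps {σ} {ok : True (all? λ i → DecMembership._∈?_ _≟_ i ps)} → Match P ps σ → Copy P B
  copy P ps {ok = ok} = match⇒copy (toWitness ok)

  infixr 5 _,,_
  -- Heads are taken in reverse direction: adjacency facts have the host on the left, whereas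
  -- `Match` has the pattern there.
  _,,_ : ∀ {a b : Bool} {as bs} → b ≡ a → as ≡ bs → _≡_ {A = List Bool} (a ∷ as) (b ∷ bs)
  refl ,, refl = refl

  symm : ∀ {u v b} → E B u v ≡ b → E B v u ≡ b
  symm {u} {v} = trans (Graph.sym B v u)

  chord : ∀ u v → (Adj B u v → R) → (E B u v ≡ false → R) → R
  chord u v = on (E B u v)

  apart : ∀ {u v w} → Adj B u v → Adj B v w → (E B u w ≡ false → R) → R
  apart {u} {v} {w} uv vw = chord u w λ uw →
    noC3 (copy C3 (# 2 ∷ # 1 ∷ # 0 ∷ []) ((symm vw ,, symm uw ,, refl) ∷ (symm uv ,, refl) ∷ refl ∷ []))

  5-cycle : ∀ {a b c d e} → Adj B a b → Adj B b c → Adj B c d → Adj B d e → Adj B e a → R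
  5-cycle ab bc cd de ea =
    apart ab bc λ ac → apart bc cd λ bd → apart cd de λ ce → apart de ea λ da → apart ea ab λ eb →
    onC5 (copy C5 (# 4 ∷ # 3 ∷ # 2 ∷ # 1 ∷ # 0 ∷ [])
      ( (symm de ,, symm ce ,, eb ,, ea ,, refl)
      ∷ (symm cd ,, symm bd ,, da ,, refl)
      ∷ (symm bc ,, symm ac ,, refl)
      ∷ (symm ab ,, refl)
      ∷ refl ∷ []))

  -- A chord spanning two edges closes a triangle; one spanning three leaves a 5-cycle on its other
  -- side.
  7-cycle : ∀ {a b c d e f g} → Adj B a b → Adj B b c → Adj B c d → Adj B d e → Adj B e f → Adj B f g → Adj B g a → R
  7-cycle {a} {b} {c} {d} {e} {f} {g} ab bc cd de ef fg ga =
    apart ab bc λ ac → apart bc cd λ bd → apart cd de λ ce → apart de ef λ df → apart ef fg λ eg →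
    apart fg ga λ fa → apart ga ab λ gb →
    chord a d (λ ad → 5-cycle ad de ef fg ga) λ ad →
    chord b e (λ be → 5-cycle be ef fg ga ab) λ be →
    chord c f (λ cf → 5-cycle cf fg ga ab bc) λ cf →
    chord d g (λ dg → 5-cycle dg ga ab bc cd) λ dg →
    chord e a (λ ea → 5-cycle ea ab bc cd de) λ ea →
    chord f b (λ fb → 5-cycle fb bc cd de ef) λ fb →
    chord g c (λ gc → 5-cycle gc cd de ef fg) λ gc →
    onC7 (copy C7 (# 6 ∷ # 5 ∷ # 4 ∷ # 3 ∷ # 2 ∷ # 1 ∷ # 0 ∷ [])
      ( (symm fg ,, symm eg ,, symm dg ,, gc ,, gb ,, ga ,, refl)
      ∷ (symm ef ,, symm df ,, symm cf ,, fb ,, fa ,, refl)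
      ∷ (symm de ,, symm ce ,, symm be ,, ea ,, refl)
      ∷ (symm cd ,, symm bd ,, symm ad ,, refl)
      ∷ (symm bc ,, symm ac ,, refl)
      ∷ (symm ab ,, refl)
      ∷ refl ∷ []))

  oddClosedWalk : ∀ k {u} → odd? k ≡ true → Walk B k u u → R
  oddClosedWalk 0 ()
  oddClosedWalk 1 _ (uu ∷ [])       = true≢false uu (irrefl B _)
  oddClosedWalk 2 ()
  oddClosedWalk 3 _ (ab ∷ bc ∷ ca ∷ []) = apart ab bc λ ac → true≢false (symm ca) ac
  oddClosedWalk 4 ()
  oddClosedWalk 5 _ (ab ∷ bc ∷ cd ∷ de ∷ ea ∷ []) = 5-cycle ab bc cd de ea
  oddClosedWalk 6 ()
  oddClosedWalk 7 _ (ab ∷ bc ∷ cd ∷ de ∷ ef ∷ fg ∷ ga ∷ []) = 7-cycle ab bc cd de ef fg ga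
  oddClosedWalk 8 ()
  oddClosedWalk (suc (suc k@(suc (suc l@(suc (suc (suc (suc (suc _))))))))) {a} odd
    (_∷_ {v = b} ab (_∷_ {v = c} bc (_∷_ {v = d} cd (_∷_ {v = e} de (_∷_ {v = f} ef (_∷_ {v = g} fg w)))))) =
    -- The edge `ab` and the path `defg` form P₂ ∪ P₄ unless a chord joins or shortcuts them. A
    -- chord over three or five edges leaves an odd closed walk of length `k` or `l`, shorter by two
    -- or four; one over two, four or six closes a cycle of length 3, 5 or 7.
    chord a d (λ ad → oddClosedWalk k odd′ (ad ∷ de ∷ ef ∷ fg ∷ w)) λ ad →
    chord a e (λ ae → 5-cycle ab bc cd de (symm ae)) λ ae →
    chord a f (λ af → oddClosedWalk l odd″ (af ∷ fg ∷ w)) λ af →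
    chord a g (λ ag → 7-cycle ab bc cd de ef fg (symm ag)) λ ag →
    apart bc cd λ bd →
    chord b e (λ be → oddClosedWalk k odd′ (ab ∷ be ∷ ef ∷ fg ∷ w)) λ be →
    chord b f (λ bf → 5-cycle bc cd de ef (symm bf)) λ bf →
    chord b g (λ bg → oddClosedWalk l odd″ (ab ∷ bg ∷ w)) λ bg →
    apart de ef λ df → apart ef fg λ eg →
    chord d g (λ dg → oddClosedWalk k odd′ (ab ∷ bc ∷ cd ∷ dg ∷ w)) λ dg →
    noP2∪P4 (copy P2∪P4 (# 5 ∷ # 4 ∷ # 3 ∷ # 2 ∷ # 1 ∷ # 0 ∷ [])
      ( (symm fg ,, symm eg ,, symm dg ,, symm bg ,, symm ag ,, refl)
      ∷ (symm ef ,, symm df ,, symm bf ,, symm af ,, refl)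
      ∷ (symm de ,, symm be ,, symm ae ,, refl)
      ∷ (symm bd ,, symm ad ,, refl)
      ∷ (symm ab ,, refl)
      ∷ refl ∷ []))
    where
    odd′ : odd? k ≡ true
    odd′ = trans (≡-sym (not-involutive (odd? k))) odd
    odd″ : odd? l ≡ true
    odd″ = trans (≡-sym (not-involutive (odd? l))) odd′

-- Deleting a neighbourhood

-- Represents G - N(z) on the unchanged vertex set: the vertices of N(z) stay but lose all their
-- edges.
isolate : (G : Graph) → V G → Graph
isolate G z = record
  { n      = n G
  ; E      = λ u v → E G u v ∧ (not (E G z u) ∧ not (E G z v))
  ; sym    = λ u v → cong₂ _∧_ (Graph.sym G u v) (∧-comm (not (E G z u)) (not (E G z v)))
  ; irrefl = λ u → cong (_∧ (not (E G z u) ∧ not (E G z u))) (irrefl G u)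
  }

NoIsolated : Graph → Set
NoIsolated P = ∀ i → ∃ λ j → E P i j ≡ true

noIsolated? : ∀ P → Dec (NoIsolated P)
noIsolated? P = all? λ i → any? λ j → E P i j ≟ᵇ true

module _ {G : Graph} {z : V G} where

  AvoidingCopy : Graph → Set
  AvoidingCopy P = Σ (Copy P G) λ { (f , _) → ∀ i → E G z (f i) ≡ false }

  -- Every image lies on a surviving edge, hence outside N(z), and between such vertices no edge was
  -- removed.
  avoidingCopy : ∀ P {ok : True (noIsolated? P)} → Copy P (isolate G z) → AvoidingCopy P
  avoidingCopy P {ok} (f , pres) = (f , pres′) , avoids
    where
    avoids : ∀ i → E G z (f i) ≡ false
    avoids i with toWitness ok i
    ... | j , ij = trans (≡-sym (not-involutive _)) (cong not (proj₁ (∧-true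
                     (proj₂ (∧-true {E G (f i) (f j)} (trans (≡-sym (pres i j)) ij))))))
    pres′ : ∀ i j → E P i j ≡ E G (f i) (f j)
    pres′ i j = trans (pres i j) (trans (cong₂ (λ a b → E G (f i) (f j) ∧ (not a ∧ not b)) (avoids i) (avoids j)) (∧-identityʳ _))

-- Blow-ups and comparable pairs

module _ {G H : Graph} (occupied : V G → Bool) (φ : V G → V H)
  (blowup : ∀ u v → E G u v ≡ occupied u ∧ (occupied v ∧ E H (φ u) (φ v))) {s t : V G} (st : Adj G s t) where

  -- An unoccupied vertex is isolated, so its empty neighbourhood lies in that of `s`, which differs
  -- from it by having the neighbour `t`.
  occupied⊎comparable : ∀ u → occupied u ≡ true ⊎ HasComparablePair G
  occupied⊎comparable u = on (occupied u) inj₁ λ empty → inj₂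
    (u , s , (λ { refl → isolated empty t st }) , isolated empty s , λ w uw → ⊥-elim (isolated empty w uw))
    where
    isolated : occupied u ≡ false → ∀ w → ¬ Adj G u w
    isolated empty w uw = true≢false (trans (≡-sym (blowup u w)) uw) (cong (_∧ (occupied w ∧ E H (φ u) (φ w))) empty)

  module _ (preserves : ∀ u v → E G u v ≡ E H (φ u) (φ v)) where

    -- Distinct vertices with the same image are nonadjacent twins.
    injective⊎comparable : ∀ u v → (φ u ≡ φ v → u ≡ v) ⊎ HasComparablePair G
    injective⊎comparable u v with u ≟ v | φ u ≟ φ v
    ... | yes u≡v | _      = inj₁ λ _ → u≡v
    ... | no _    | no ne  = inj₁ (⊥-elim ∘ ne)
    ... | no u≢v  | yes eq = inj₂ (u , v , u≢v
      , (λ uv → true≢false uv (trans (preserves u v) (trans (cong (E H (φ u)) (≡-sym eq)) (irrefl H (φ u)))))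
      , λ w uw → trans (preserves v w) (trans (cong (λ c → E H c (φ w)) (≡-sym eq)) (trans (≡-sym (preserves u w)) uw)))

  blowup⇒comparable⊎embeds : HasComparablePair G ⊎ (G ↪ᵢ H)
  blowup⇒comparable⊎embeds with forAll occupied⊎comparable
  ... | inj₂ c   = inj₁ c
  ... | inj₁ occ = [ (λ inj → inj₂ record { f = φ ; injective = inj _ _ ; preserves = preserves }) , inj₁ ]′
                     (forAll₂ (injective⊎comparable preserves))
    where
    preserves : ∀ u v → E G u v ≡ E H (φ u) (φ v)
    preserves u v = trans (blowup u v) (cong₂ (λ a b → a ∧ (b ∧ E H (φ u) (φ v))) (occ u) (occ v))

-- Colouring or embedding a graph without C₃ and P₂ ∪ P₄

module FreeGraph (G : Graph) (P2∪P4-free : ¬ (P2∪P4 ↪ᵢ G)) (C3-free : ¬ (C3 ↪ᵢ G)) where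

  open Host G

  noC3 : Copy C3 G → ⊥
  noC3 = C3-free ∘ copy⇒embedding (toWitness {a? = pointDetermining? C3} _)

  noP2∪P4 : Copy P2∪P4 G → ⊥
  noP2∪P4 = P2∪P4-free ∘ copy⇒embedding (toWitness {a? = pointDetermining? P2∪P4} _)

  Outcome : Set
  Outcome = χ≤ G 3 ⊎ Copy F1 G

  extend : ∀ H goals (col : List Bool → Fin 3) → colours col goals (rows H) ≡ true →
    All (λ P → Copy P G → Outcome) goals → Copy H G → Outcome
  extend H goals col ok onGoals h =
    [ inj₁ , id ]′ (colourHost (⊥-elim ∘ noC3) (⊥-elim ∘ noP2∪P4) goals onGoals _ (rows-copy {H} h) col ok)

  fromX11 : Copy (X 11) G → Outcome
  fromX11 = extend (X 11) (F1 ∷ []) (colour 11) X11-colours (inj₂ ∷ [])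

  fromX10 : Copy (X 10) G → Outcome
  fromX10 = extend (X 10) (X 11 ∷ F1 ∷ []) (colour 10) X10-colours (fromX11 ∷ inj₂ ∷ [])

  fromX9 : Copy (X 9) G → Outcome
  fromX9 = extend (X 9) (X 10 ∷ []) (colour 9) X9-colours (fromX10 ∷ [])

  fromX8 : Copy (X 8) G → Outcome
  fromX8 = extend (X 8) (X 9 ∷ []) (colour 8) X8-colours (fromX9 ∷ [])

  fromX7 : Copy (X 7) G → Outcome
  fromX7 = extend (X 7) (X 8 ∷ []) (colour 7) X7-colours (fromX8 ∷ [])

  module _ {z y : V G} (zy : Adj G z y) where

    fromAvoiding : ∀ {P} goals → avoidsFirst goals (beyond P) ≡ true → All (λ Q → Copy Q G → Outcome) goals →
      AvoidingCopy {G} {z} P → Outcome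
    fromAvoiding {P} goals ok onGoals (h@(f , _) , avoids) =
      firstNonadjacent (⊥-elim ∘ noC3) (⊥-elim ∘ noP2∪P4) goals onGoals (z ∷ ρ) M≡ y ok refl
        (trans (Graph.sym G y z) zy)
      where
      ρ : List (V G)
      ρ = map f (allFin (n P))
      M≡ : beyond P ≡ adjacency (z ∷ ρ) (z ∷ ρ)
      M≡ = trans (cong₂ _▹_ (rows-copy {P} h) (trans (map-cong (≡-sym ∘ avoids) _) (map-∘ _))) (adjacency-▹ z ρ)

    oddOutcome : OddClosedWalk (isolate G z) → Outcome
    oddOutcome (k , u , odd , w) = oddClosedWalk k odd w
      where
      open OddCycle {isolate G z} {Outcome}
        (⊥-elim ∘ noC3 ∘ proj₁ ∘ avoidingCopy {G} {z} C3)
        (⊥-elim ∘ noP2∪P4 ∘ proj₁ ∘ avoidingCopy {G} {z} P2∪P4)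
        (fromAvoiding {C5} (X 7 ∷ []) C5-beyond (fromX7 ∷ []) ∘ avoidingCopy {G} {z} C5)
        (fromAvoiding {C7} [] C7-beyond [] ∘ avoidingCopy {G} {z} C7)

    bipartiteOutcome : Bipartite (isolate G z) → χ≤ G 3
    bipartiteOutcome (side , proper) = (λ x → pick (E G z x) (side x)) , λ u v uv → differ u v uv
      where
      pick : Bool → Bool → Fin 3
      pick true  _     = # 2
      pick false true  = # 1
      pick false false = # 0
      sides : ∀ {a b} → a ≡ not b → pick false a ≢ pick false b
      sides {true}  {false} _ ()
      sides {false} {true}  _ ()
      apart : ∀ {u v} → E G z u ≡ true → E G z v ≡ true → Adj G u v → ⊥
      apart zu zv uv = noC3 (match⇒copy {C3}
        (toWitness {a? = all? λ i → DecMembership._∈?_ _≟_ i (# 2 ∷ # 1 ∷ # 0 ∷ [])} _)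
        (≡-sym (cong₂ (λ a b → a ∷ b ∷ []) (trans (Graph.sym G _ _) uv) (trans (Graph.sym G _ _) zv))
          ∷ ≡-sym (cong (_∷ []) (trans (Graph.sym G _ _) zu)) ∷ refl ∷ []))
      differ : ∀ u v → Adj G u v → pick (E G z u) (side u) ≢ pick (E G z v) (side v)
      differ u v uv eq with E G z u in zu | E G z v in zv | proper u v
      ... | true  | true  | _ = apart zu zv uv
      ... | false | false | p = sides (p (trans (∧-identityʳ _) uv)) eq
      ... | true  | false | _ with side v
      differ u v uv () | true  | false | _ | true
      differ u v uv () | true  | false | _ | false
      differ u v uv eq | false | true  | _ with side u
      differ u v uv () | false | true  | _ | true
      differ u v uv () | false | true  | _ | false

  outcome : Outcome
  outcome with any? (λ z → any? (λ y → E G z y ≟ᵇ true))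
  ... | no  noEdge       = inj₁ ((λ _ → # 0) , λ u v uv _ → noEdge (u , v , uv))
  ... | yes (z , y , zy) = [ inj₁ ∘ bipartiteOutcome zy , oddOutcome zy ]′ (bipartite⊎oddClosedWalk (isolate G z))

  clebschOutcome : Copy F1 G → HasComparablePair G ⊎ (G ↪ᵢ F2)
  clebschOutcome h@(f , pres) = blowup⇒comparable⊎embeds (λ u → or (trace u ρ)) (λ u → code (trace u ρ))
    -- The edge v₁v₂ of the copy of F₁ serves as the edge required for comparing isolated vertices.
    (predicted noC3 noP2∪P4 clebsch ρ (rows-copy {F1} h) F1-predicts) (≡-sym (pres (# 0) (# 1)))
    where
    ρ : List (V G)
    ρ = map f (allFin 11)

theorem1p2 : (G : Graph) → Connected G → ¬ (P2∪P4 ↪ᵢ G) → ¬ (C3 ↪ᵢ G) →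
    HasComparablePair G ⊎ (χ≤ G 3 ⊎ ((F1 ↪ᵢ G) × (G ↪ᵢ F2)))
theorem1p2 G connected P2∪P4-free C3-free with FreeGraph.outcome G P2∪P4-free C3-free
... | inj₁ χ≤3 = inj₂ (inj₁ χ≤3)
... | inj₂ h   = [ inj₁ , (λ e → inj₂ (inj₂ (copy⇒embedding (toWitness {a? = pointDetermining? F1} _) h , e))) ]′
                   (FreeGraph.clebschOutcome G P2∪P4-free C3-free h)
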